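{- Let $k\ge 1$ be an integer, let $g$ be a graph and let $S\subseteq V(g)$ be a $k$-defective clique. Let $\pi_1,\dots,\pi_c$ be the color classes of a proper coloring with $c$ colors of the subgraph of $g$ induced by $V(g)\setminus S$ (so $\pi_1,\dots,\pi_c$ partition $V(g)\setminus S$ into independent sets). For each $i$, order the vertices of $\pi_i$ as $v_{i_1},v_{i_2},\dots,v_{i_{|\pi_i|}}$ in non-decreasing order of $|\overline{N}_S(\cdot)|$, and define weights $$w(v_{i_j})=|\overline{N}_S(v_{i_j})|+j-1,\qquad 1\le j\le |\pi_i|.$$ Let $v_1,v_2,\dots,v_{|V(g)\setminus S|}$ be an ordering of $V(g)\setminus S$ in non-decreasing order of the weights $w(\cdot)$. Let $i^*$ be the largest integer $i$ with $0\le i\le |V(g)\setminus S|$ such that $$\sum_{j=1}^{i} w(v_j)\le k-|\overline{E}(S)|.$$ Then every $k$-defective clique $C$ with $S\subseteq C\subseteq V(g)$ satisfies $|C|\le |S|+i^*$.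
   Context: All graphs are finite, simple and undirected. For a vertex set $A\subseteq V(g)$, $\overline{E}(A)$ is the set of non-edges (unordered pairs of distinct non-adjacent vertices) of the subgraph of $g$ induced by $A$; $A$ is a $k$-defective clique if $|\overline{E}(A)|\le k$. $\overline{N}_S(u)$ denotes the set of vertices of $S$ that are different from $u$ and not adjacent to $u$ in $g$. -}

module Defs where

open import Data.Nat.Base using (ℕ; _+_; _∸_; _≤_)
open import Data.Nat.ListAction using (sum)
open import Data.Nat.Properties using (≤-totalOrder)
open import Data.Fin.Base using (Fin; toℕ; _<_)
open import Data.Fin.Properties using (_≟_; _<?_)
open import Data.Fin.Subset using (Subset; _∈_; _⊆_; ∁; ∣_∣)
open import Data.Fin.Subset.Properties using (_∈?_)
open import Data.List.Base using (List; length; map; filter; take; lookup; allFin; cartesianProduct)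
import Data.List.Membership.Propositional as List
open import Data.List.Relation.Unary.Unique.Propositional using (Unique)
open import Data.List.Relation.Unary.Sorted.TotalOrder ≤-totalOrder using (Sorted)
open import Data.Product.Base using (∃-syntax; _×_; _,_)
open import Function.Bundles using (_⇔_)
open import Relation.Binary.PropositionalEquality.Core using (_≡_)
open import Relation.Nullary using (Dec; ¬_; ¬?; _×-dec_)

record Graph (n : ℕ) : Set₁ where
  field
    Adj    : Fin n → Fin n → Set
    adj?   : ∀ u v → Dec (Adj u v)
    sym    : ∀ {u v} → Adj u v → Adj v u
    irrefl : ∀ {v} → ¬ Adj v v

module _ {n : ℕ} (g : Graph n) where
  open Graph g

  -- An unordered pair {u , v} is represented by (u , v) with u < v.
  nonEdges : Subset n → List (Fin n × Fin n)
  nonEdges A =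
    filter (λ (u , v) → u <? v ×-dec u ∈? A ×-dec v ∈? A ×-dec ¬? (adj? u v))
           (cartesianProduct (allFin n) (allFin n))

  ∣Ē_∣ : Subset n → ℕ
  ∣Ē A ∣ = length (nonEdges A)

  IsDefectiveClique : ℕ → Subset n → Set
  IsDefectiveClique k A = ∣Ē A ∣ ≤ k

  nonNeighbours : Subset n → Fin n → List (Fin n)
  nonNeighbours S u =
    filter (λ v → v ∈? S ×-dec ¬? (v ≟ u) ×-dec ¬? (adj? u v)) (allFin n)

  ∣N̄_∣ : Subset n → Fin n → ℕ
  ∣N̄ S ∣ u = length (nonNeighbours S u)

  -- π lists the colour classes of a proper colouring, with c colours, of the
  -- subgraph induced by U.  A colour may be unused, so classes may be empty.
  record IsProperColouring (U : Subset n) {c : ℕ} (π : Fin c → Subset n) : Set where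
    field
      within      : ∀ i → π i ⊆ U
      cover       : ∀ {v} → v ∈ U → ∃[ i ] v ∈ π i
      disjoint    : ∀ {v i j} → v ∈ π i → v ∈ π j → i ≡ j
      independent : ∀ {u v i} → u ∈ π i → v ∈ π i → ¬ Adj u v

record IsOrderingOf {n : ℕ} (A : Subset n) (f : Fin n → ℕ) (xs : List (Fin n)) : Set where
  field
    unique        : Unique xs
    members       : ∀ v → (v List.∈ xs) ⇔ (v ∈ A)
    nonDecreasing : Sorted (map f xs)

-- Positions are counted from 0, so toℕ j is the "j - 1" of the usual 1-based
-- formula.  Given orderings σ of the colour classes of a colouring of V ∖ S,
-- this determines w on V ∖ S; values of w on S are unconstrained and unused.
IsWeight : ∀ {n c} → Graph n → Subset n → (Fin c → List (Fin n)) → (Fin n → ℕ) → Set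
IsWeight g S σ w =
  ∀ i (j : Fin (length (σ i))) → w (lookup (σ i) j) ≡ ∣N̄_∣ g S (lookup (σ i) j) + toℕ j

record IsLargest (P : ℕ → Set) (m : ℕ) : Set where
  field
    holds   : P m
    maximal : ∀ i → P i → i ≤ m

-- The truncated subtraction is exact whenever S is a k-defective clique.
PrefixFits : ∀ {n} → Graph n → ℕ → Subset n → (Fin n → ℕ) → List (Fin n) → ℕ → Set
PrefixFits g k S w vs i =
  i ≤ ∣ ∁ S ∣ × sum (map w (take i vs)) ≤ k ∸ ∣Ē_∣ g S

{-# OPTIONS --safe #-}

-- Let D = C ∖ S and let d i be the number of vertices of D in the colour class π i.
-- Apart from the non-edges inside S, C contains at least Σ_{v ∈ D} ∣N̄ S∣ v
-- non-edges between D and S, and Σ_i (0 + 1 + … + (d i ∸ 1)) non-edges inside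
-- D, because colour classes are independent.  Replacing the vertices of D in
-- π i by the first d i vertices of π i can only lower the first sum and turns the total
-- into the weight of the new set.  The new set has ∣ D ∣ elements, so its
-- weight is at least that of the ∣ D ∣ lightest vertices; hence these fit the budget
-- k ∸ ∣Ē S∣, and ∣ D ∣ ≤ i*.
module Submission where

open import Defs
open import Data.Nat.Base using (ℕ; _+_; _≤_; _≥_)
open import Data.Fin.Base using (Fin)
open import Data.Fin.Subset using (Subset; _⊆_; ∁; ∣_∣)
open import Data.List.Base using (List)

open import Data.Bool.Base using (true; false)
open import Data.Fin.Base using (zero; suc; toℕ) renaming (_<_ to _<ᶠ_)
open import Data.Fin.Properties using (_≟_; _<?_; <-cmp)
import Data.Fin.Properties as Fin
open import Data.Fin.Subset using (_∈_; inside; outside)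
open import Data.Fin.Subset.Properties using (_∈?_; x∈p⇒x∉∁p; x∉p⇒x∈∁p)
open import Data.List.Base
  using ([]; _∷_; _++_; allFin; cartesianProduct; concat; downFrom; filter; length; lookup; map; tabulate; take)
import Data.List.Membership.Propositional as List
open import Data.List.Membership.Propositional.Properties
  using (∈-∃++; ∈-++⁺ˡ; ∈-++⁺ʳ; ∈-++⁻; ∈-allFin; ∈-cartesianProduct⁺; ∈-concat⁺′; ∈-concat⁻′
        ; ∈-filter⁺; ∈-filter⁻; ∈-map⁺; ∈-map⁻)
import Data.List.Membership.DecPropositional as DecMembership
open import Data.List.Properties
  using (filter-++; filter-all; length-++; length-map; length-take; map-++; map-tabulate; take++drop≡id)
open import Data.List.Relation.Binary.Disjoint.Propositional using (Disjoint)
open import Data.List.Relation.Binary.Permutation.Propositional using (_↭_; ↭-sym; ↭⇒↭ₛ)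
open import Data.List.Relation.Binary.Permutation.Propositional.Properties
  using (shift; ↭-length; ∈-resp-↭) renaming (map⁺ to ↭-map⁺)
open import Data.List.Relation.Binary.Permutation.Setoid.Properties using (Unique-resp-↭)
open import Data.List.Relation.Binary.Subset.Propositional using () renaming (_⊆_ to _⊑_)
open import Data.List.Relation.Binary.Subset.Propositional.Properties using (⊆∷∧∉⇒⊆)
open import Data.List.Relation.Unary.All as All using (All; []; _∷_)
import Data.List.Relation.Unary.All.Properties as All
open import Data.List.Relation.Unary.AllPairs as AllPairs using (AllPairs; []; _∷_)
import Data.List.Relation.Unary.AllPairs.Properties as AllPairs
open import Data.List.Relation.Unary.Any using (here; there)
open import Data.List.Relation.Unary.Sorted.TotalOrder.Properties using (Sorted⇒AllPairs)
open import Data.List.Relation.Unary.Unique.Propositional using (Unique)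
open import Data.List.Relation.Unary.Unique.Propositional.Properties
  using (Unique[x∷xs]⇒x∉xs; allFin⁺; cartesianProduct⁺; concat⁺; filter⁺; take⁺)
  renaming (map⁺ to Unique-map⁺; ++⁺ to Unique-++⁺)
open import Data.Nat.Base using (zero; suc; _*_; _∸_; z≤n; s≤s)
open import Data.Nat.ListAction using (sum)
open import Data.Nat.ListAction.Properties using (sum-++; sum-↭)
open import Data.Nat.Properties hiding (_≟_; _<?_; <-cmp)
open import Data.Nat.Solver using (module +-*-Solver)
open import Data.Product.Base using (∃-syntax; _×_; _,_; proj₁; proj₂)
open import Data.Product.Properties using (,-injective)
open import Data.Sum.Base using (_⊎_; inj₁; inj₂; [_,_]′)
open import Data.Vec.Base using ([]; _∷_)
open import Function.Base using (_∘_; id)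
open import Function.Bundles using (module Equivalence)
open import Relation.Binary.Definitions using (tri<; tri≈; tri>)
open import Relation.Binary.PropositionalEquality
  using (_≡_; _≢_; refl; sym; trans; cong; cong₂; subst; setoid)
open import Relation.Nullary using (¬_; ¬?; yes; no; does; contradiction)

-- Duplicate-free lists

∈⇒↭∷ : ∀ {A : Set} {x : A} {ys} → x List.∈ ys → ∃[ zs ] ys ↭ x ∷ zs
∈⇒↭∷ x∈ys with as , bs , refl ← ∈-∃++ x∈ys = as ++ bs , shift _ as bs

-- The pigeonhole principle, by pulling the head of `xs` to the front of `ys` and removing it from
-- both. Cardinalities below are compared by exhibiting an inclusion from a duplicate-free list.
Unique-⊆⇒length≤ : ∀ {A : Set} {xs ys : List A} → Unique xs → xs ⊑ ys → length xs ≤ length ys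
Unique-⊆⇒length≤ {xs = []}     _             _     = z≤n
Unique-⊆⇒length≤ {xs = x ∷ xs} x∷xs!@(_ ∷ xs!) x∷xs⊑ys
  with zs , ys↭x∷zs ← ∈⇒↭∷ (x∷xs⊑ys (here refl)) =
  ≤-trans (s≤s (Unique-⊆⇒length≤ xs! xs⊑zs)) (≤-reflexive (sym (↭-length ys↭x∷zs)))
  where
  xs⊑zs : xs ⊑ zs
  xs⊑zs = ⊆∷∧∉⇒⊆ (∈-resp-↭ ys↭x∷zs ∘ x∷xs⊑ys ∘ there) (Unique[x∷xs]⇒x∉xs x∷xs!)

take-⊆ : ∀ {A : Set} m (xs : List A) → take m xs ⊑ xs
take-⊆ m xs v∈ = subst (_ List.∈_) (take++drop≡id m xs) (∈-++⁺ˡ v∈)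

concat-unique : ∀ {A : Set} {c} (ρ : Fin c → List A) → (∀ i → Unique (ρ i)) →
  (∀ {i j v} → v List.∈ ρ i → v List.∈ ρ j → i ≡ j) → Unique (concat (map ρ (allFin c)))
concat-unique {c = c} ρ ρ! ρ# = concat⁺
  (All.map⁺ (All.universal ρ! (allFin c)))
  (AllPairs.map⁺ (AllPairs.map (λ i≢j {_} (v∈i , v∈j) → i≢j (ρ# v∈i v∈j)) (allFin⁺ c)))

-- Initial segments of sorted lists

module _ {n : ℕ} where

  open DecMembership (_≟_ {n}) using () renaming (_∈?_ to _∈ˡ?_)

  -- Greedy exchange: if the minimum `x` occurs in `ys`, it cancels on both sides; otherwise some
  -- entry of `ys` can be traded for it. It serves twice, with `f` the number of non-neighbours in
  -- `S` within a colour class, and with `f` the weight on all of `∁ S`.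
  prefix-minimal : (f : Fin n → ℕ) → ∀ {xs ys} → AllPairs (λ x y → f x ≤ f y) xs →
    Unique ys → ys ⊑ xs → sum (map f (take (length ys) xs)) ≤ sum (map f ys)
  prefix-minimal f {[]}     {[]}     _ _ _ = z≤n
  prefix-minimal f {[]}     {y ∷ ys} _ _ y∷ys⊑[] = contradiction (y∷ys⊑[] (here refl)) λ ()
  prefix-minimal f {x ∷ xs} {[]}     _ _ _ = z≤n
  prefix-minimal f {x ∷ xs} {ys@(y ∷ ys′)} (x≤xs ∷ xs↗) ys! ys⊑x∷xs with x ∈ˡ? ys
  ... | yes x∈ys with zs , ys↭x∷zs ← ∈⇒↭∷ x∈ys = begin
    sum (map f (take (length ys) (x ∷ xs)))  ≡⟨ cong (λ m → sum (map f (take m (x ∷ xs)))) (↭-length ys↭x∷zs) ⟩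
    f x + sum (map f (take (length zs) xs))  ≤⟨ +-monoʳ-≤ (f x) (prefix-minimal f xs↗ (AllPairs.tail x∷zs!) zs⊑xs) ⟩
    f x + sum (map f zs)                     ≡⟨ sum-↭ (↭-map⁺ f ys↭x∷zs) ⟨
    sum (map f ys)                           ∎
    where
    open ≤-Reasoning
    x∷zs! : Unique (x ∷ zs)
    x∷zs! = Unique-resp-↭ (setoid _) (↭⇒↭ₛ ys↭x∷zs) ys!
    zs⊑xs : zs ⊑ xs
    zs⊑xs = ⊆∷∧∉⇒⊆ (ys⊑x∷xs ∘ ∈-resp-↭ (↭-sym ys↭x∷zs) ∘ there) (Unique[x∷xs]⇒x∉xs x∷zs!)
  -- Without `x`, all of `ys` lies in `xs`: the entry `y` pays for `x`, and `ys′` pays for the rest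
  -- of the prefix.
  ... | no x∉ys = +-mono-≤ (All.lookup x≤xs (ys⊑xs (here refl)))
                           (prefix-minimal f xs↗ (AllPairs.tail ys!) (ys⊑xs ∘ there))
    where
    ys⊑xs : ys ⊑ xs
    ys⊑xs = ⊆∷∧∉⇒⊆ ys⊑x∷xs x∉ys

  ordering⇒AllPairs : ∀ {A : Subset n} {f xs} → IsOrderingOf A f xs → AllPairs (λ x y → f x ≤ f y) xs
  ordering⇒AllPairs o = AllPairs.map⁻ (Sorted⇒AllPairs ≤-totalOrder (IsOrderingOf.nonDecreasing o))

  -- Vertex sets as duplicate-free lists

  elements : Subset n → List (Fin n)
  elements A = filter (_∈? A) (allFin n)

  elements-unique : ∀ A → Unique (elements A)
  elements-unique A = filter⁺ (_∈? A) (allFin⁺ n)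

  ∈-elements⁺ : ∀ {A v} → v ∈ A → v List.∈ elements A
  ∈-elements⁺ {A} = ∈-filter⁺ (_∈? A) (∈-allFin _)

  ∈-elements⁻ : ∀ {A v} → v List.∈ elements A → v ∈ A
  ∈-elements⁻ {A} = proj₂ ∘ ∈-filter⁻ (_∈? A) {xs = allFin n}

-- Unfolding `allFin (suc n)` leaves `tabulate suc` after its first entry. Membership of `suc x` in
-- `t ∷ A` is decided as that of `x` in `A`, whatever `t` is.
length-elements-tail : ∀ {n} t (A : Subset n) →
  length (filter (_∈? (t ∷ A)) (tabulate suc)) ≡ length (elements A)
length-elements-tail {n} t A =
  trans (cong (length ∘ filter (_∈? (t ∷ A))) (sym (map-tabulate id suc))) (filter-suc (allFin n))
  where
  filter-suc : ∀ xs → length (filter (_∈? (t ∷ A)) (map suc xs)) ≡ length (filter (_∈? A) xs)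
  filter-suc []       = refl
  filter-suc (x ∷ xs) with does (x ∈? A)
  ... | true  = cong suc (filter-suc xs)
  ... | false = filter-suc xs

length-elements : ∀ {n} (A : Subset n) → length (elements A) ≡ ∣ A ∣
length-elements []            = refl
length-elements (inside  ∷ A) = cong suc (trans (length-elements-tail inside A) (length-elements A))
length-elements (outside ∷ A) = trans (length-elements-tail outside A) (length-elements A)

-- Non-edges of lists of vertices

-- The normal form of an unordered pair in `nonEdges`, smaller end first; it makes a non-edge
-- independent of the order in which a list presents its ends.
ordered : ∀ {n} → Fin n → Fin n → Fin n × Fin n
ordered u v with u <? v
... | yes _ = u , v
... | no  _ = v , u

ordered-< : ∀ {n} {u v : Fin n} → u <ᶠ v → ordered u v ≡ (u , v)
ordered-< {u = u} {v} u<v with u <? v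
... | yes _   = refl
... | no  u≮v = contradiction u<v u≮v

ordered-> : ∀ {n} {u v : Fin n} → v <ᶠ u → ordered u v ≡ (v , u)
ordered-> {u = u} {v} v<u with u <? v
... | yes u<v = contradiction v<u (Fin.<-asym u<v)
... | no  _   = refl

ordered-≡ : ∀ {n} (u v x y : Fin n) → ordered u v ≡ ordered x y → (u ≡ x × v ≡ y) ⊎ (u ≡ y × v ≡ x)
ordered-≡ u v x y eq with u <? v | x <? y
... | yes _ | yes _ = inj₁ (,-injective eq)
... | yes _ | no  _ = inj₂ (,-injective eq)
... | no  _ | yes _ = let v≡x , u≡y = ,-injective eq in inj₂ (u≡y , v≡x)
... | no  _ | no  _ = let v≡y , u≡x = ,-injective eq in inj₁ (u≡x , v≡y)

module _ {n : ℕ} (g : Graph n) where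
  open Graph g renaming (sym to Adj-sym)

  nonAdjacent : Fin n → List (Fin n) → List (Fin n)
  nonAdjacent u = filter (λ v → ¬? (adj? u v))

  ∈-nonAdjacent⁻ : ∀ {u v} xs → v List.∈ nonAdjacent u xs → v List.∈ xs × ¬ Adj u v
  ∈-nonAdjacent⁻ {u} xs = ∈-filter⁻ (λ v → ¬? (adj? u v)) {xs = xs}

  ∈-nonAdjacent⁺ : ∀ {u v xs} → v List.∈ xs → ¬ Adj u v → v List.∈ nonAdjacent u xs
  ∈-nonAdjacent⁺ {u} = ∈-filter⁺ (λ v → ¬? (adj? u v))

  -- Each non-edge is recorded at whichever end comes first in the list. Unlike filtering all pairs,
  -- this recursion lets the count be split along `∷` and `++`.
  nonEdgesOf : List (Fin n) → List (Fin n × Fin n)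
  nonEdgesOf []       = []
  nonEdgesOf (x ∷ xs) = map (ordered x) (nonAdjacent x xs) ++ nonEdgesOf xs

  length-nonEdgesOf-∷ : ∀ x xs → length (nonEdgesOf (x ∷ xs)) ≡ length (nonAdjacent x xs) + length (nonEdgesOf xs)
  length-nonEdgesOf-∷ x xs = trans (length-++ (map (ordered x) (nonAdjacent x xs)))
                              (cong (_+ length (nonEdgesOf xs)) (length-map (ordered x) (nonAdjacent x xs)))

  ∈-nonEdgesOf⁻ : ∀ {p} xs → Unique xs → p List.∈ nonEdgesOf xs →
    ∃[ u ] ∃[ v ] p ≡ ordered u v × u List.∈ xs × v List.∈ xs × u ≢ v × ¬ Adj u v
  ∈-nonEdgesOf⁻ (x ∷ xs) x∷xs!@(_ ∷ xs!) p∈ with ∈-++⁻ (map (ordered x) (nonAdjacent x xs)) p∈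
  ... | inj₁ p∈x with v , v∈ , p≡ ← ∈-map⁻ (ordered x) p∈x =
    let v∈xs , x≁v = ∈-nonAdjacent⁻ xs v∈ in
    x , v , p≡ , here refl , there v∈xs , (λ { refl → Unique[x∷xs]⇒x∉xs x∷xs! v∈xs }) , x≁v
  ... | inj₂ p∈xs with u , v , p≡ , u∈ , v∈ , rest ← ∈-nonEdgesOf⁻ xs xs! p∈xs =
    u , v , p≡ , there u∈ , there v∈ , rest

  ∈-nonEdgesOf⁺ : ∀ {u v} xs → u <ᶠ v → u List.∈ xs → v List.∈ xs → ¬ Adj u v → (u , v) List.∈ nonEdgesOf xs
  ∈-nonEdgesOf⁺ (x ∷ xs) u<v (here refl) (here refl) _   = contradiction u<v (Fin.<-irrefl refl)
  ∈-nonEdgesOf⁺ (x ∷ xs) u<v (here refl) (there v∈)  u≁v = ∈-++⁺ˡ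
    (subst (List._∈ map (ordered x) (nonAdjacent x xs)) (ordered-< u<v)
      (∈-map⁺ (ordered x) (∈-nonAdjacent⁺ v∈ u≁v)))
  ∈-nonEdgesOf⁺ (x ∷ xs) u<v (there u∈)  (here refl) u≁v = ∈-++⁺ˡ
    (subst (List._∈ map (ordered x) (nonAdjacent x xs)) (ordered-> u<v)
      (∈-map⁺ (ordered x) (∈-nonAdjacent⁺ u∈ (u≁v ∘ Adj-sym))))
  ∈-nonEdgesOf⁺ (x ∷ xs) u<v (there u∈)  (there v∈)  u≁v = ∈-++⁺ʳ _ (∈-nonEdgesOf⁺ xs u<v u∈ v∈ u≁v)

  -- The pairs recorded at `x` all contain `x`, whereas those recorded later have both ends in `xs`,
  -- where `x` does not occur.
  nonEdgesOf-unique : ∀ xs → Unique xs → Unique (nonEdgesOf xs)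
  nonEdgesOf-unique []       _ = []
  nonEdgesOf-unique (x ∷ xs) x∷xs!@(_ ∷ xs!) =
    Unique-++⁺ (Unique-map⁺ ordered-injective (filter⁺ _ xs!)) (nonEdgesOf-unique xs xs!) disj
    where
    ordered-injective : ∀ {u v} → ordered x u ≡ ordered x v → u ≡ v
    ordered-injective {u} {v} eq with ordered-≡ x u x v eq
    ... | inj₁ (_ , u≡v)   = u≡v
    ... | inj₂ (x≡v , u≡x) = trans u≡x x≡v

    disj : Disjoint (map (ordered x) (nonAdjacent x xs)) (nonEdgesOf xs)
    disj (p∈x , p∈xs) with v , _ , refl ← ∈-map⁻ (ordered x) p∈x
      with a , b , eq , a∈ , b∈ , _ ← ∈-nonEdgesOf⁻ xs xs! p∈xs with ordered-≡ x v a b eq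
    ... | inj₁ (refl , _) = Unique[x∷xs]⇒x∉xs x∷xs! a∈
    ... | inj₂ (refl , _) = Unique[x∷xs]⇒x∉xs x∷xs! b∈

  ∈-nonEdges⁺ : ∀ {A u v} → u <ᶠ v → u ∈ A → v ∈ A → ¬ Adj u v → (u , v) List.∈ nonEdges g A
  ∈-nonEdges⁺ u<v u∈A v∈A u≁v =
    ∈-filter⁺ _ (∈-cartesianProduct⁺ (∈-allFin _) (∈-allFin _)) (u<v , u∈A , v∈A , u≁v)

  -- Together with the converse bound `∣Ē∣≤length-nonEdgesOf`, this identifies the recursive count
  -- with `∣Ē A ∣` when `xs` enumerates `A` without repetition.
  length-nonEdgesOf≤∣Ē∣ : ∀ {A xs} → Unique xs → (∀ {v} → v List.∈ xs → v ∈ A) → length (nonEdgesOf xs) ≤ ∣Ē_∣ g A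
  length-nonEdgesOf≤∣Ē∣ {A} {xs} xs! xs⊆A = Unique-⊆⇒length≤ (nonEdgesOf-unique xs xs!) sub
    where
    sub : nonEdgesOf xs ⊑ nonEdges g A
    sub p∈ with u , v , refl , u∈ , v∈ , u≢v , u≁v ← ∈-nonEdgesOf⁻ xs xs! p∈ with <-cmp u v
    ... | tri< u<v _ _ = subst (List._∈ nonEdges g A) (sym (ordered-< u<v))
                           (∈-nonEdges⁺ u<v (xs⊆A u∈) (xs⊆A v∈) u≁v)
    ... | tri≈ _ u≡v _ = contradiction u≡v u≢v
    ... | tri> _ _ v<u = subst (List._∈ nonEdges g A) (sym (ordered-> v<u))
                           (∈-nonEdges⁺ v<u (xs⊆A v∈) (xs⊆A u∈) (u≁v ∘ Adj-sym))

  ∣Ē∣≤length-nonEdgesOf : ∀ {A xs} → (∀ {v} → v ∈ A → v List.∈ xs) → ∣Ē_∣ g A ≤ length (nonEdgesOf xs)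
  ∣Ē∣≤length-nonEdgesOf {A} {xs} A⊆xs =
    Unique-⊆⇒length≤ (filter⁺ _ (cartesianProduct⁺ (allFin⁺ n) (allFin⁺ n))) sub
    where
    sub : nonEdges g A ⊑ nonEdgesOf xs
    sub p∈ with _ , u<v , u∈A , v∈A , u≁v ← ∈-filter⁻ _ {xs = cartesianProduct (allFin n) (allFin n)} p∈ =
      ∈-nonEdgesOf⁺ xs u<v (A⊆xs u∈A) (A⊆xs v∈A) u≁v

  ∣N̄∣≤length-nonAdjacent : ∀ {S xs} u → (∀ {v} → v ∈ S → v List.∈ xs) →
    ∣N̄_∣ g S u ≤ length (nonAdjacent u xs)
  ∣N̄∣≤length-nonAdjacent {S} {xs} u S⊆xs = Unique-⊆⇒length≤ (filter⁺ _ (allFin⁺ n)) sub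
    where
    sub : nonNeighbours g S u ⊑ nonAdjacent u xs
    sub v∈ with _ , v∈S , _ , u≁v ← ∈-filter⁻ _ {xs = allFin n} v∈ = ∈-nonAdjacent⁺ (S⊆xs v∈S) u≁v

  -- The non-edges of `xs ++ ys` lie inside `xs`, inside `ys`, or cross between them; `f u` is a
  -- lower bound for the crossing ones at `u`. In the induction, `nonAdjacent x (xs ++ ys)` splits
  -- into its inner and its crossing part.
  length-nonEdgesOf-++ : (f : Fin n → ℕ) → ∀ xs ys → (∀ u → f u ≤ length (nonAdjacent u ys)) →
    sum (map f xs) + length (nonEdgesOf xs) + length (nonEdgesOf ys) ≤ length (nonEdgesOf (xs ++ ys))
  length-nonEdgesOf-++ f []       ys f≤ = ≤-refl
  length-nonEdgesOf-++ f (x ∷ xs) ys f≤ = begin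
    f x + F + length (nonEdgesOf (x ∷ xs)) + Y  ≡⟨ cong (λ m → f x + F + m + Y) (length-nonEdgesOf-∷ x xs) ⟩
    f x + F + (d + P) + Y                  ≡⟨ rearrange (f x) F d P Y ⟩
    (d + f x) + (F + P + Y)                ≤⟨ +-mono-≤ (+-monoʳ-≤ d (f≤ x)) (length-nonEdgesOf-++ f xs ys f≤) ⟩
    (d + length (nonAdjacent x ys)) + Q    ≡⟨ cong (_+ Q) (length-++ (nonAdjacent x xs)) ⟨
    length (nonAdjacent x xs ++ nonAdjacent x ys) + Q
                                           ≡⟨ cong (λ zs → length zs + Q) (filter-++ _ xs ys) ⟨
    length (nonAdjacent x (xs ++ ys)) + Q  ≡⟨ length-nonEdgesOf-∷ x (xs ++ ys) ⟨
    length (nonEdgesOf (x ∷ xs ++ ys))          ∎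
    where
    open ≤-Reasoning
    F = sum (map f xs)
    d = length (nonAdjacent x xs)
    P = length (nonEdgesOf xs)
    Y = length (nonEdgesOf ys)
    Q = length (nonEdgesOf (xs ++ ys))
    rearrange : ∀ a b c d e → a + b + (c + d) + e ≡ (c + a) + (b + d + e)
    rearrange = +-*-Solver.solve 5 (λ a b c d e → a :+ b :+ (c :+ d) :+ e := (c :+ a) :+ (b :+ d :+ e)) refl
      where open +-*-Solver

  -- Every pair of positions gives a non-edge, so an entry with `r` successors contributes `r`. The
  -- total is the binomial coefficient of `length xs` over 2, kept as a sum to match the positions
  -- in the weights.
  length-nonEdgesOf-independent : ∀ xs → (∀ {u v} → u List.∈ xs → v List.∈ xs → ¬ Adj u v) →
    length (nonEdgesOf xs) ≡ sum (downFrom (length xs))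
  length-nonEdgesOf-independent []       _   = refl
  length-nonEdgesOf-independent (x ∷ xs) ind = trans (length-nonEdgesOf-∷ x xs)
    (cong₂ _+_ (cong length (filter-all _ (All.tabulate (ind (here refl) ∘ there))))
               (length-nonEdgesOf-independent xs (λ u∈ v∈ → ind (there u∈) (there v∈))))

-- Weights

-- The offset o makes the induction on xs go through.
sum-take-weights : ∀ {A : Set} (w f : A → ℕ) o xs →
  (∀ j → w (lookup xs j) ≡ f (lookup xs j) + (o + toℕ j)) → ∀ m →
  sum (map w (take m xs)) ≤ sum (map f (take m xs)) + (m * o + sum (downFrom m))
sum-take-weights w f o xs       w≡ zero    = z≤n
-- The list ends early while the right side still counts `suc m` positions; this case makes the
-- claim an inequality.
sum-take-weights w f o []       w≡ (suc m) = z≤n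
sum-take-weights w f o (x ∷ xs) w≡ (suc m) = begin
  w x + sum (map w (take m xs))            ≤⟨ +-mono-≤ (≤-reflexive (w≡ zero)) ih ⟩
  (f x + (o + 0)) + (F + (m * suc o + T))  ≡⟨ rearrange (f x) o F m T ⟩
  (f x + F) + (suc m * o + (m + T))        ∎
  where
  open ≤-Reasoning
  F = sum (map f (take m xs))
  T = sum (downFrom m)
  ih : sum (map w (take m xs)) ≤ F + (m * suc o + T)
  ih = sum-take-weights w f (suc o) xs
    (λ j → trans (w≡ (suc j)) (cong (f (lookup xs j) +_) (+-suc o (toℕ j)))) m
  rearrange : ∀ a o F m T → (a + (o + 0)) + (F + (m * suc o + T)) ≡ (a + F) + (suc m * o + (m + T))
  rearrange = +-*-Solver.solve 5 (λ a o F m T →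
    (a :+ (o :+ con 0)) :+ (F :+ (m :* (con 1 :+ o) :+ T)) := (a :+ F) :+ ((con 1 :+ m) :* o :+ (m :+ T))) refl
    where open +-*-Solver

module _ {n : ℕ} (g : Graph n) where
  open Graph g using (Adj)

  -- The exchange inside one colour class. The position terms of the first `length ys` vertices add
  -- up to exactly the number of non-edges of the independent list `ys`, and the `f` terms are
  -- minimal on a prefix.
  sum-weights-prefix : (w f : Fin n → ℕ) → ∀ {xs ys} →
    (∀ j → w (lookup xs j) ≡ f (lookup xs j) + toℕ j) → AllPairs (λ x y → f x ≤ f y) xs →
    Unique ys → ys ⊑ xs → (∀ {u v} → u List.∈ ys → v List.∈ ys → ¬ Adj u v) →
    sum (map w (take (length ys) xs)) ≤ sum (map f ys) + length (nonEdgesOf g ys)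
  sum-weights-prefix w f {xs} {ys} w≡ xs↗ ys! ys⊑xs ind = begin
    sum (map w (take m xs))
      ≤⟨ sum-take-weights w f 0 xs w≡ m ⟩
    F + (m * 0 + sum (downFrom m))
      ≡⟨ cong (λ z → F + (z + sum (downFrom m))) (*-zeroʳ m) ⟩
    F + sum (downFrom m)
      ≡⟨ cong (F +_) (length-nonEdgesOf-independent g ys ind) ⟨
    F + length (nonEdgesOf g ys)
      ≤⟨ +-monoˡ-≤ _ (prefix-minimal f xs↗ ys! ys⊑xs) ⟩
    sum (map f ys) + length (nonEdgesOf g ys) ∎
    where
    open ≤-Reasoning
    m = length ys
    F = sum (map f (take m xs))

  -- The class bounds are added up; non-edges between different classes only enlarge the right side.
  sum-concat-≤ : ∀ {I : Set} (w f : Fin n → ℕ) (τ δ : I → List (Fin n)) →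
    (∀ i → sum (map w (τ i)) ≤ sum (map f (δ i)) + length (nonEdgesOf g (δ i))) → ∀ is →
    sum (map w (concat (map τ is))) ≤
      sum (map f (concat (map δ is))) + length (nonEdgesOf g (concat (map δ is)))
  sum-concat-≤ w f τ δ ≤i []       = z≤n
  sum-concat-≤ w f τ δ ≤i (i ∷ is) = begin
    sum (map w (τ i ++ concat (map τ is)))
      ≡⟨ sum-map-++ w (τ i) _ ⟩
    sum (map w (τ i)) + sum (map w (concat (map τ is)))
      ≤⟨ +-mono-≤ (≤i i) (sum-concat-≤ w f τ δ ≤i is) ⟩
    (a + p) + (b + q)
      ≡⟨ rearrange a p b q ⟩
    (a + b) + (p + q)
      ≤⟨ +-monoʳ-≤ (a + b) p+q≤ ⟩
    (a + b) + length (nonEdgesOf g (δ i ++ D))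
      ≡⟨ cong (_+ length (nonEdgesOf g (δ i ++ D))) (sum-map-++ f (δ i) D) ⟨
    sum (map f (δ i ++ D)) + length (nonEdgesOf g (δ i ++ D)) ∎
    where
    open ≤-Reasoning
    D = concat (map δ is)
    a = sum (map f (δ i))
    p = length (nonEdgesOf g (δ i))
    b = sum (map f D)
    q = length (nonEdgesOf g D)
    sum-map-++ : ∀ (h : Fin n → ℕ) xs ys → sum (map h (xs ++ ys)) ≡ sum (map h xs) + sum (map h ys)
    sum-map-++ h xs ys = trans (cong sum (map-++ h xs ys)) (sum-++ (map h xs) (map h ys))
    p+q≤ : p + q ≤ length (nonEdgesOf g (δ i ++ D))
    -- With `f` the exact crossing count, the hypothesis on `f` is reflexivity; the crossing term is
    -- then dropped.
    p+q≤ = ≤-trans (+-monoˡ-≤ q (m≤n+m p _))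
      (length-nonEdgesOf-++ g (λ u → length (nonAdjacent g u D)) (δ i) D (λ _ → ≤-refl))
    rearrange : ∀ a b c d → (a + b) + (c + d) ≡ (a + c) + (b + d)
    rearrange = +-*-Solver.solve 4 (λ a b c d → (a :+ b) :+ (c :+ d) := (a :+ c) :+ (b :+ d)) refl
      where open +-*-Solver

length-concat-cong : ∀ {A I : Set} (τ δ : I → List A) → (∀ i → length (τ i) ≡ length (δ i)) →
  ∀ is → length (concat (map τ is)) ≡ length (concat (map δ is))
length-concat-cong τ δ eq []       = refl
length-concat-cong τ δ eq (i ∷ is) = trans (length-++ (τ i))
  (trans (cong₂ _+_ (eq i) (length-concat-cong τ δ eq is)) (sym (length-++ (δ i))))

-- The bound on the size of the clique

mainTheorem2 : (k : ℕ) → k ≥ 1 →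
    (n : ℕ) (g : Graph n) (S : Subset n) → IsDefectiveClique g k S →
    (c : ℕ) (π : Fin c → Subset n) → IsProperColouring g (∁ S) π →
    (σ : Fin c → List (Fin n)) → (∀ i → IsOrderingOf (π i) (∣N̄_∣ g S) (σ i)) →
    (w : Fin n → ℕ) → IsWeight g S σ w →
    (vs : List (Fin n)) → IsOrderingOf (∁ S) w vs →
    (i* : ℕ) → IsLargest (PrefixFits g k S w vs) i* →
    (C : Subset n) → IsDefectiveClique g k C → S ⊆ C →
    ∣ C ∣ ≤ ∣ S ∣ + i*
mainTheorem2 k _ n g S _ c π colouring σ σ-ordering w weight vs vs-ordering i* largest C C-defective S⊆C = begin
  ∣ C ∣                              ≡⟨ length-elements C ⟨
  length (elements C)                ≤⟨ Unique-⊆⇒length≤ (elements-unique C) (C⊆D++S ∘ ∈-elements⁻) ⟩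
  length (D ++ elements S)           ≡⟨ length-++ D ⟩
  length D + length (elements S)     ≡⟨ +-comm (length D) _ ⟩
  length (elements S) + length D     ≡⟨ cong (_+ length D) (length-elements S) ⟩
  ∣ S ∣ + length D                   ≤⟨ +-monoʳ-≤ ∣ S ∣ (IsLargest.maximal largest (length D) (∣D∣≤ , fits)) ⟩
  ∣ S ∣ + i*                         ∎
  where
  open ≤-Reasoning
  open IsProperColouring colouring

  N̄ = ∣N̄_∣ g S

  σ⇒π : ∀ {i v} → v List.∈ σ i → v ∈ π i
  σ⇒π {i} = Equivalence.to (IsOrderingOf.members (σ-ordering i) _)

  π⇒σ : ∀ {i v} → v ∈ π i → v List.∈ σ i
  π⇒σ {i} = Equivalence.from (IsOrderingOf.members (σ-ordering i) _)

  δ τ : Fin c → List (Fin n)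
  δ i = filter (_∈? C) (σ i)
  τ i = take (length (δ i)) (σ i)

  δ⊑σ : ∀ i → δ i ⊑ σ i
  δ⊑σ i = proj₁ ∘ ∈-filter⁻ (_∈? C) {xs = σ i}

  τ⊑σ : ∀ i → τ i ⊑ σ i
  τ⊑σ i = take-⊆ (length (δ i)) (σ i)

  σ! : ∀ i → Unique (σ i)
  σ! i = IsOrderingOf.unique (σ-ordering i)

  -- `D` enumerates `C ∖ S`. The exchanged list `T` may leave `C`; what matters is its size, its
  -- weight and that it avoids `S`.
  D T : List (Fin n)
  D = concat (map δ (allFin c))
  T = concat (map τ (allFin c))

  ∈D⁻ : ∀ {v} → v List.∈ D → ∃[ i ] v List.∈ δ i
  ∈D⁻ v∈D with _ , v∈ , δi∈ ← ∈-concat⁻′ (map δ (allFin c)) v∈D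
    with i , _ , refl ← ∈-map⁻ δ δi∈ = i , v∈

  ∈T⇒∈∁S : ∀ {v} → v List.∈ T → v ∈ ∁ S
  ∈T⇒∈∁S v∈T with _ , v∈ , τi∈ ← ∈-concat⁻′ (map τ (allFin c)) v∈T
    with i , _ , refl ← ∈-map⁻ τ τi∈ = within i (σ⇒π (τ⊑σ i v∈))

  ∈D⇒∈C : ∀ {v} → v List.∈ D → v ∈ C
  ∈D⇒∈C v∈D = let i , v∈ = ∈D⁻ v∈D in proj₂ (∈-filter⁻ (_∈? C) {xs = σ i} v∈)

  ∈D⇒∈∁S : ∀ {v} → v List.∈ D → v ∈ ∁ S
  ∈D⇒∈∁S v∈D = let i , v∈ = ∈D⁻ v∈D in within i (σ⇒π (δ⊑σ i v∈))

  D! : Unique D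
  D! = concat-unique δ (λ i → filter⁺ _ (σ! i)) (λ v∈i v∈j → disjoint (σ⇒π (δ⊑σ _ v∈i)) (σ⇒π (δ⊑σ _ v∈j)))

  T! : Unique T
  T! = concat-unique τ (λ i → take⁺ _ (σ! i)) (λ v∈i v∈j → disjoint (σ⇒π (τ⊑σ _ v∈i)) (σ⇒π (τ⊑σ _ v∈j)))

  ∣T∣≡∣D∣ : length T ≡ length D
  ∣T∣≡∣D∣ = length-concat-cong τ δ
    -- `take` gives the minimum of `length (δ i)` and `length (σ i)`, which is the former because
    -- `δ i` is a duplicate-free part of `σ i`.
    (λ i → trans (length-take (length (δ i)) (σ i))
                 (m≤n⇒m⊓n≡m (Unique-⊆⇒length≤ (filter⁺ _ (σ! i)) (δ⊑σ i))))
    (allFin c)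

  C⊆D++S : ∀ {v} → v ∈ C → v List.∈ D ++ elements S
  C⊆D++S {v} v∈C with v ∈? S
  ... | yes v∈S = ∈-++⁺ʳ D (∈-elements⁺ v∈S)
  ... | no  v∉S = let i , v∈πi = cover (x∉p⇒x∈∁p v∉S) in
    ∈-++⁺ˡ (∈-concat⁺′ (∈-filter⁺ (_∈? C) (π⇒σ v∈πi) v∈C) (∈-map⁺ δ (∈-allFin i)))

  ∣D∣≤ : length D ≤ ∣ ∁ S ∣
  ∣D∣≤ = ≤-trans (Unique-⊆⇒length≤ D! (∈-elements⁺ ∘ ∈D⇒∈∁S)) (≤-reflexive (length-elements (∁ S)))

  D++S! : Unique (D ++ elements S)
  D++S! = Unique-++⁺ D! (elements-unique S)
    (λ (v∈D , v∈S) → x∈p⇒x∉∁p (∈-elements⁻ v∈S) (∈D⇒∈∁S v∈D))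

  -- The three summands account for the non-edges of `C` between `D` and `S`, inside `D` and inside
  -- `S`. The additive form is what yields the bound by the truncated difference in `fits`.
  nonEdges-bound : sum (map N̄ D) + length (nonEdgesOf g D) + ∣Ē_∣ g S ≤ k
  nonEdges-bound = begin
    sum (map N̄ D) + length (nonEdgesOf g D) + ∣Ē_∣ g S
      ≤⟨ +-monoʳ-≤ (sum (map N̄ D) + length (nonEdgesOf g D)) (∣Ē∣≤length-nonEdgesOf g ∈-elements⁺) ⟩
    sum (map N̄ D) + length (nonEdgesOf g D) + length (nonEdgesOf g (elements S))
      ≤⟨ length-nonEdgesOf-++ g N̄ D (elements S) (λ u → ∣N̄∣≤length-nonAdjacent g u ∈-elements⁺) ⟩
    length (nonEdgesOf g (D ++ elements S))
      ≤⟨ length-nonEdgesOf≤∣Ē∣ g D++S! ([ ∈D⇒∈C , S⊆C ∘ ∈-elements⁻ ]′ ∘ ∈-++⁻ D) ⟩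
    ∣Ē_∣ g C
      ≤⟨ C-defective ⟩
    k ∎

  class-bound : ∀ i → sum (map w (τ i)) ≤ sum (map N̄ (δ i)) + length (nonEdgesOf g (δ i))
  class-bound i = sum-weights-prefix g w N̄ (weight i) (ordering⇒AllPairs (σ-ordering i))
    (filter⁺ _ (σ! i)) (δ⊑σ i)
    (λ u∈ v∈ → independent (σ⇒π (δ⊑σ i u∈)) (σ⇒π (δ⊑σ i v∈)))

  fits : sum (map w (take (length D) vs)) ≤ k ∸ ∣Ē_∣ g S
  fits = begin
    -- The comparison goes through `T` because vertices of `D` may stand late in their classes, so
    -- that the weight of `D` itself could exceed its number of non-edges.
    sum (map w (take (length D) vs))     ≡⟨ cong (λ m → sum (map w (take m vs))) ∣T∣≡∣D∣ ⟨
    sum (map w (take (length T) vs))     ≤⟨ prefix-minimal w (ordering⇒AllPairs vs-ordering) T!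
                                              (Equivalence.from (IsOrderingOf.members vs-ordering _) ∘ ∈T⇒∈∁S) ⟩
    sum (map w T)                        ≤⟨ sum-concat-≤ g w N̄ τ δ class-bound (allFin c) ⟩
    sum (map N̄ D) + length (nonEdgesOf g D)   ≤⟨ m+n≤o⇒m≤o∸n _ nonEdges-bound ⟩
    k ∸ ∣Ē_∣ g S           ∎
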